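{- Let $n\ge 3$, $1\le t<n$, and let $c_1,c_2,\ldots,c_t\in[n]$ be distinct integers such that the sequence $(c_1,\ldots,c_t)$ avoids both patterns $132$ and $213$. If there exist $\alpha,\beta\in[n]\setminus\{c_1,\ldots,c_t\}$ and $i\in[t]$ with $\min\{c_1,\ldots,c_t\}<\alpha<c_i<\beta$, then $|S_{n,(c_1,\ldots,c_t)}(132,213)|=0$; if there exist $\alpha\in[n]\setminus\{c_1,\ldots,c_t\}$ and $i,j\in[t]$ with $i<j$ such that $c_i<\alpha<c_j$ or $c_j<c_i<\alpha$, then $|S_{n,(c_1,\ldots,c_t)}(132,213)|=0$; otherwise (if neither condition holds), $$|S_{n,(c_1,\ldots,c_t)}(132,213)|=2^{\max\{0,\min\{c_1,\ldots,c_t\}-2\}}.$$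
   Context: $[n]=\{1,\ldots,n\}$ and $S_n$ is the set of permutations of $[n]$ written as sequences $(\tau(1),\ldots,\tau(n))$. A sequence of distinct integers $\tau=(\tau(1),\ldots,\tau(m))$ contains $\sigma\in S_k$ as a pattern if there are indices $1\le i_1<\cdots<i_k\le m$ such that for all $1\le a<b\le k$, $\tau(i_a)<\tau(i_b)$ if and only if $\sigma(a)<\sigma(b)$; otherwise $\tau$ avoids $\sigma$. $S_{n,(c_1,\ldots,c_t)}(\sigma_1,\ldots,\sigma_m)$ is the set of $\tau\in S_n$ with $(\tau(1),\ldots,\tau(t))=(c_1,\ldots,c_t)$ that avoid all of $\sigma_1,\ldots,\sigma_m$. -}

module Defs where

open import Data.Fin as Fin using (Fin)
open import Data.List as List using (List; length)
open import Data.List.Membership.Propositional using (_∈_)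
open import Data.List.Relation.Binary.Permutation.Propositional using (_↭_)
open import Data.List.Relation.Unary.All using (All)
open import Data.List.Relation.Unary.Unique.Propositional using (Unique)
open import Data.Nat using (ℕ; suc; _<_; _⊓_; NonZero)
open import Data.Product using (Σ-syntax; ∃; ∃-syntax; _×_; _,_)
open import Data.Sum using (_⊎_)
open import Data.Vec using (Vec; []; _∷_; lookup; toList; foldr₁)
open import Data.Vec.Membership.Propositional using () renaming (_∉_ to _∉ᵛ_)
open import Function.Bundles using (_⇔_)
open import Relation.Binary.PropositionalEquality using (_≡_)
open import Relation.Nullary using (¬_)

[1⋯_] : ℕ → List ℕ
[1⋯ n ] = List.map suc (List.upTo n)

IsPermutation : ∀ {n} → Vec ℕ n → Set
IsPermutation {n} τ = toList τ ↭ [1⋯ n ]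

infix 4 _contains_ _avoids_

-- Positions are 0-based (Fin), while entries are the actual integers.
_contains_ : ∀ {m k} → Vec ℕ m → Vec ℕ k → Set
_contains_ {m} {k} τ σ =
  Σ[ ι ∈ (Fin k → Fin m) ]
    (∀ a b → a Fin.< b → ι a Fin.< ι b) ×
    (∀ a b → a Fin.< b →
      lookup τ (ι a) < lookup τ (ι b) ⇔ lookup σ a < lookup σ b)

_avoids_ : ∀ {m k} → Vec ℕ m → Vec ℕ k → Set
τ avoids σ = ¬ (τ contains σ)

p132 p213 : Vec ℕ 3
p132 = 1 ∷ 3 ∷ 2 ∷ []
p213 = 2 ∷ 1 ∷ 3 ∷ []

-- S n c σs is the set S_{n,(c₁,…,c_t)}(σ₁,…,σ_m), as a predicate on sequences;
-- each pattern is paired with its length.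
S : ∀ n {t} → Vec ℕ t → List (∃[ k ] Vec ℕ k) → Vec ℕ n → Set
S n {t} c σs τ =
  IsPermutation τ ×
  List.take t (toList τ) ≡ toList c ×
  All (λ (_ , σ) → τ avoids σ) σs

-- P holds of exactly k elements: they are enumerated, without repetition,
-- by a list of length k.
HasCardinality : {A : Set} → (A → Set) → ℕ → Set
HasCardinality {A} P k =
  Σ[ xs ∈ List A ] Unique xs × (∀ x → x ∈ xs ⇔ P x) × length xs ≡ k

minimum : ∀ {t} .{{_ : NonZero t}} → Vec ℕ t → ℕ
minimum {suc _} c = foldr₁ _⊓_ c

-- α ∈ [n] ∖ {c₁,…,c_t}
Unused : ∀ n {t} → Vec ℕ t → ℕ → Set
Unused n c α = α ∈ [1⋯ n ] × α ∉ᵛ c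

Condition₁ : ∀ n {t} .{{_ : NonZero t}} → Vec ℕ t → Set
Condition₁ n {t} c =
  ∃[ α ] ∃[ β ] Σ[ i ∈ Fin t ]
    Unused n c α × Unused n c β ×
    minimum c < α × α < lookup c i × lookup c i < β

Condition₂ : ∀ n {t} → Vec ℕ t → Set
Condition₂ n {t} c =
  ∃[ α ] Σ[ i ∈ Fin t ] Σ[ j ∈ Fin t ]
    Unused n c α × i Fin.< j ×
    ((lookup c i < α × α < lookup c j) ⊎
     (lookup c j < lookup c i × lookup c i < α))

{-# OPTIONS --safe #-}
module Submission where

-- Let m be the least entry of the prefix c.  The unused values above m must
-- all come before those below m and in increasing order, so an admissible
-- permutation is c, then an increasing run, then an avoider ρ of [m − 1].  Such
-- a concatenation avoids 132 and 213 for every ρ unless an occurrence uses an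
-- entry of c together with unused values above m, which is what the two
-- conditions describe.  The avoiders of [k] are counted by first entry a: the
-- prefix (a) satisfies neither condition, so it leaves as many extensions as
-- there are avoiders of [a − 1], whence 2^(k − 1) avoiders for k ≥ 1.

open import Data.Fin as Fin using (Fin; zero; suc)
open import Data.List as List using (List; _∷_; []; _++_; length; filter; upTo)
open import Data.List.Membership.DecPropositional using () renaming (_∈?_ to member?)
open import Data.List.Membership.Propositional using (_∈_; _∉_)
open import Data.List.Membership.Propositional.Properties
  using (∈-map⁺; ∈-map⁻; ∈-++⁺ˡ; ∈-++⁺ʳ; ∈-++⁻; ∈-filter⁺; ∈-filter⁻; ∈-upTo⁺; ∈-upTo⁻)
open import Data.List.Membership.Propositional.Properties.WithK using (unique∧set⇒bag)
open import Data.List.Properties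
  using (length-map; length-++; length-upTo; ++-assoc; ++-cancelˡ; take++drop≡id;
         filter-none; filter-all)
open import Data.List.Relation.Binary.BagAndSetEquality using (∼bag⇒↭)
open import Data.List.Relation.Binary.Equality.Propositional using (≋⇒≡)
open import Data.List.Relation.Binary.Permutation.Propositional using (_↭_; ↭-sym; ↭⇒↭ₛ)
open import Data.List.Relation.Binary.Permutation.Propositional.Properties
  using (∈-resp-↭; ↭-length)
open import Data.List.Relation.Binary.Permutation.Setoid.Properties using (Unique-resp-↭)
open import Data.List.Relation.Binary.Sublist.Propositional
  using (_⊆_; []; _∷_; _∷ʳ_; ⊆-trans; from∈; to∈; lookup) renaming (minimum to []⊆)
open import Data.List.Relation.Binary.Sublist.Propositional.Properties
  using (filter-⊆; ∷ˡ⁻) renaming (++⁺ to ⊆-++⁺; ++⁺ˡ to ⊆-++⁺ˡ; ++⁺ʳ to ⊆-++⁺ʳ)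
open import Data.List.Relation.Unary.All as Allₗ using ([]; _∷_)
open import Data.List.Relation.Unary.AllPairs as AllPairs using (AllPairs; []; _∷_)
open import Data.List.Relation.Unary.AllPairs.Properties as AllPairs using ()
open import Data.List.Relation.Unary.Any using (here; there)
open import Data.List.Relation.Unary.Sorted.TotalOrder.Properties
  using (AllPairs⇒Sorted; ↗↭↗⇒≋)
open import Data.List.Relation.Unary.Unique.Propositional using () renaming (Unique to Uniqueₗ)
open import Data.List.Relation.Unary.Unique.Propositional.Properties as Unique using ()
open import Data.Nat
  using (ℕ; zero; suc; _≤_; _<_; _+_; _^_; _∸_; _<?_; NonZero; s≤s; z≤n; s<s; z<s)
open import Data.Nat.Properties
open import Data.Product using (Σ-syntax; ∃; _×_; _,_; proj₁; proj₂)
open import Data.Sum as Sum using (_⊎_; inj₁; inj₂; [_,_]; [_,_]′)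
open import Data.Vec as Vec using (Vec; []; _∷_; toList)
open import Data.Vec.Membership.Propositional.Properties using (∈-lookup; ∈-toList⁺; ∈-toList⁻)
open import Data.Vec.Properties using (cast-is-id; toList-injective; toList∘fromList)
open import Data.Vec.Relation.Unary.All as All using (All)
open import Data.Vec.Relation.Unary.AllPairs using ([]; _∷_)
open import Data.Vec.Relation.Unary.All.Properties as All using ()
open import Data.Vec.Relation.Unary.Unique.Propositional using (Unique)
open import Function using (_∘_; id)
open import Function.Bundles using (_⇔_; mk⇔; Equivalence)
open import Relation.Binary.Definitions using (tri<; tri≈; tri>)
open import Relation.Binary.PropositionalEquality
  using (_≡_; _≢_; refl; sym; trans; cong; cong₂; subst; subst₂; setoid)
open import Relation.Nullary using (¬_; yes; no; contradiction; ¬?; _×-dec_)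
open import Relation.Unary using (Decidable)
open import Defs

open Equivalence using (to; from)

-- Cardinalities

card-∅ : {A : Set} {P : A → Set} → (∀ x → ¬ P x) → HasCardinality P 0
card-∅ ¬P = [] , [] , (λ x → mk⇔ (λ ()) (λ p → contradiction p (¬P x))) , refl

card-cong : {A : Set} {P Q : A → Set} {k : ℕ} →
  (∀ x → P x ⇔ Q x) → HasCardinality P k → HasCardinality Q k
card-cong P⇔Q (xs , xs! , xs⇔P , |xs|) =
  xs , xs! ,
  (λ x → mk⇔ (to (P⇔Q x) ∘ to (xs⇔P x)) (from (xs⇔P x) ∘ from (P⇔Q x))) ,
  |xs|

card-image : {A B : Set} {P : A → Set} {k : ℕ} (f : A → B) →
  (∀ {x y} → f x ≡ f y → x ≡ y) →
  HasCardinality P k → HasCardinality (λ y → ∃ λ x → P x × y ≡ f x) k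
card-image f f-inj (xs , xs! , xs⇔P , |xs|) =
  List.map f xs , Unique.map⁺ f-inj xs! ,
  (λ y → mk⇔
    (λ y∈ → let x , x∈ , y≡ = ∈-map⁻ f y∈ in x , to (xs⇔P x) x∈ , y≡)
    (λ where (x , px , refl) → ∈-map⁺ f (from (xs⇔P x) px))) ,
  trans (length-map f xs) |xs|

card-⊎ : {A : Set} {P Q : A → Set} {a b : ℕ} → (∀ x → P x → ¬ Q x) →
  HasCardinality P a → HasCardinality Q b → HasCardinality (λ x → P x ⊎ Q x) (a + b)
card-⊎ P⇒¬Q (xs , xs! , xs⇔P , |xs|) (ys , ys! , ys⇔Q , |ys|) =
  xs ++ ys ,
  Unique.++⁺ xs! ys! (λ (∈xs , ∈ys) → P⇒¬Q _ (to (xs⇔P _) ∈xs) (to (ys⇔Q _) ∈ys)) ,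
  (λ x → mk⇔
    (Sum.map (to (xs⇔P x)) (to (ys⇔Q x)) ∘ ∈-++⁻ xs)
    [ ∈-++⁺ˡ ∘ from (xs⇔P x) , ∈-++⁺ʳ xs ∘ from (ys⇔Q x) ]) ,
  trans (length-++ xs) (cong₂ _+_ |xs| |ys|)

fromLists : {A : Set} {n : ℕ} (ls : List (List A)) → Allₗ.All (λ l → length l ≡ n) ls →
  ∃ λ (vs : List (Vec A n)) → List.map toList vs ≡ ls
fromLists []       _                = [] , refl
fromLists (l ∷ ls) (refl ∷ ps) =
  let vs , eq = fromLists ls ps in
  Vec.fromList l ∷ vs , cong₂ _∷_ (toList∘fromList l) eq

-- Counting is done on lists, where concatenation carries no length index. The fixed length makes
-- every enumerated list the image of a vector, and `toList` is injective on vectors of one length.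
card-toList : {A : Set} {P : List A → Set} {n k : ℕ} → (∀ {l} → P l → length l ≡ n) →
  HasCardinality P k → HasCardinality {Vec A n} (P ∘ toList) k
card-toList P⇒len (ls , ls! , ls⇔P , |ls|)
  with fromLists ls (Allₗ.tabulate (λ l∈ → P⇒len (to (ls⇔P _) l∈)))
... | vs , refl =
  vs , Unique.map⁻ ls! ,
  (λ v → mk⇔
    (to (ls⇔P _) ∘ ∈-map⁺ toList)
    (λ pv → let w , w∈ , eq = ∈-map⁻ toList (from (ls⇔P _) pv) in
            subst (_∈ vs) (sym (toList-inj v w eq)) w∈)) ,
  trans (sym (length-map toList vs)) |ls|
  where
  toList-inj : ∀ v w → toList v ≡ toList w → v ≡ w
  toList-inj v w eq = trans (sym (cast-is-id refl v)) (toList-injective refl v w eq)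

-- Sublists

-- Used to sort the occurrences of a pattern in a concatenation by the number of entries that fall
-- into the first block.
⊆-++⁻ : {A : Set} {zs : List A} (xs : List A) {ys : List A} → zs ⊆ xs ++ ys →
  ∃ λ as → ∃ λ bs → zs ≡ as ++ bs × as ⊆ xs × bs ⊆ ys
⊆-++⁻ []       p          = [] , _ , refl , [] , p
⊆-++⁻ (x ∷ xs) (.x ∷ʳ p)  = let as , bs , eq , p₁ , p₂ = ⊆-++⁻ xs p in
                            as , bs , eq , x ∷ʳ p₁ , p₂
⊆-++⁻ (x ∷ xs) (refl ∷ p) = let as , bs , eq , p₁ , p₂ = ⊆-++⁻ xs p in
                            x ∷ as , bs , cong (x ∷_) eq , refl ∷ p₁ , p₂

module _ {A : Set} {R : A → A → Set} where

  -- Two-element sublists stand for pairs of positions in increasing order; in this form uniqueness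
  -- and sortedness pass to sublists by transitivity.
  AllPairs⇒⊆ : ∀ {l} → AllPairs R l → ∀ {x y} → x ∷ y ∷ [] ⊆ l → R x y
  AllPairs⇒⊆ (_  ∷ rs) (_ ∷ʳ p)   = AllPairs⇒⊆ rs p
  AllPairs⇒⊆ (r  ∷ rs) (refl ∷ p) = Allₗ.lookup r (to∈ p)

  ⊆⇒AllPairs : ∀ l → (∀ {x y} → x ∷ y ∷ [] ⊆ l → R x y) → AllPairs R l
  ⊆⇒AllPairs []      _ = []
  ⊆⇒AllPairs (x ∷ l) f =
    Allₗ.tabulate (λ y∈ → f (refl ∷ from∈ y∈)) ∷ ⊆⇒AllPairs l (f ∘ (x ∷ʳ_))

∈∧∈⇒⊆ : {A : Set} {x y : A} {l : List A} → x ≢ y → x ∈ l → y ∈ l →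
  x ∷ y ∷ [] ⊆ l ⊎ y ∷ x ∷ [] ⊆ l
∈∧∈⇒⊆ x≢y (here refl) (here refl) = contradiction refl x≢y
∈∧∈⇒⊆ x≢y (here refl) (there y∈)  = inj₁ (refl ∷ from∈ y∈)
∈∧∈⇒⊆ x≢y (there x∈)  (here refl) = inj₂ (refl ∷ from∈ x∈)
∈∧∈⇒⊆ x≢y (there x∈)  (there y∈)  = Sum.map (_ ∷ʳ_) (_ ∷ʳ_) (∈∧∈⇒⊆ x≢y x∈ y∈)

filter-++-filter-¬ : {A : Set} {P : A → Set} (P? : Decidable P) (l : List A) →
  (∀ {x y} → x ∷ y ∷ [] ⊆ l → P y → P x) →
  filter P? l ++ filter (¬? ∘ P?) l ≡ l
filter-++-filter-¬ P? []      _ = refl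
filter-++-filter-¬ P? (x ∷ l) f with P? x
... | yes _  = cong (x ∷_) (filter-++-filter-¬ P? l (f ∘ (x ∷ʳ_)))
-- From the first failure of `P` on, everything fails, so on the tail one filter is empty and the
-- other is the identity.
... | no ¬px
  rewrite filter-none P? {l} (Allₗ.tabulate (λ y∈ → ¬px ∘ f (refl ∷ from∈ y∈)))
        | filter-all (¬? ∘ P?) {l} (Allₗ.tabulate (λ y∈ → ¬px ∘ f (refl ∷ from∈ y∈)))
  = refl

-- Strictly increasing lists have no repetition, so equal sets of entries make them permutations of
-- each other, and two sorted permutations of each other coincide.
sorted-unique : {l l′ : List ℕ} → AllPairs _<_ l → AllPairs _<_ l′ →
  (∀ {x} → x ∈ l ⇔ x ∈ l′) → l ≡ l′
sorted-unique l< l′< l⇔l′ = ≋⇒≡ (↗↭↗⇒≋ ≤-totalOrder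
  (AllPairs⇒Sorted ≤-totalOrder (AllPairs.map <⇒≤ l<))
  (AllPairs⇒Sorted ≤-totalOrder (AllPairs.map <⇒≤ l′<))
  (↭⇒↭ₛ (∼bag⇒↭ (unique∧set⇒bag (AllPairs.map <⇒≢ l<) (AllPairs.map <⇒≢ l′<) l⇔l′))))

-- Permutations of [n] avoiding 132 and 213

∈[1⋯]⇔ : ∀ {n x} → x ∈ [1⋯ n ] ⇔ (1 ≤ x × x ≤ n)
∈[1⋯]⇔ = mk⇔
  (λ x∈ → let _ , i∈ , eq = ∈-map⁻ suc x∈ in
          subst (λ x → 1 ≤ x × x ≤ _) (sym eq) (s≤s z≤n , ∈-upTo⁻ i∈))
  (λ where (s≤s z≤n , x≤n) → ∈-map⁺ suc (∈-upTo⁺ x≤n))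

[1⋯]-sorted : ∀ n → AllPairs _<_ [1⋯ n ]
[1⋯]-sorted n = AllPairs.map⁺ (AllPairs.applyUpTo⁺₁ id n (λ i<j _ → s<s i<j))

-- This form of being a permutation lets filters and concatenations be treated by membership alone;
-- `↭⇔Perm` links it to `IsPermutation`.
Perm : ℕ → List ℕ → Set
Perm n l = Uniqueₗ l × (∀ x → x ∈ l ⇔ x ∈ [1⋯ n ])

↭⇔Perm : ∀ {n l} → (l ↭ [1⋯ n ]) ⇔ Perm n l
↭⇔Perm {n} = mk⇔
  (λ l↭ → Unique-resp-↭ (setoid ℕ) (↭⇒↭ₛ (↭-sym l↭)) [1⋯n]! ,
          λ x → mk⇔ (∈-resp-↭ l↭) (∈-resp-↭ (↭-sym l↭)))
  (λ (l! , l⇔) → ∼bag⇒↭ (unique∧set⇒bag l! [1⋯n]! (l⇔ _)))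
  where [1⋯n]! = AllPairs.map <⇒≢ ([1⋯]-sorted n)

Perm⇒length : ∀ {n l} → Perm n l → length l ≡ n
Perm⇒length {n} lₚ =
  trans (↭-length (from ↭⇔Perm lₚ)) (trans (length-map suc (upTo n)) (length-upTo n))

-- The left alternative is an occurrence of 132, the right one of 213.
Bad : ℕ → ℕ → ℕ → Set
Bad x y z = (x < z × z < y) ⊎ (y < x × x < z)

Avoiding : List ℕ → Set
Avoiding l = ∀ {x y z} → x ∷ y ∷ z ∷ [] ⊆ l → ¬ Bad x y z

Avoider : ℕ → List ℕ → Set
Avoider n l = Perm n l × Avoiding l

Avoiding-⊆ : ∀ {l l′} → l ⊆ l′ → Avoiding l′ → Avoiding l
Avoiding-⊆ l⊆l′ av p = av (⊆-trans p l⊆l′)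

Bad⇒< : ∀ {x y z} → Bad x y z → x < z
Bad⇒< = [ proj₁ , proj₂ ]

-- Both 132 and 213 end above their first entry, so an occurrence cannot start in the higher block
-- and end in the lower one: it lies within a single block.
Avoiding-skew : ∀ {high low} → (∀ {x z} → x ∈ high → z ∈ low → z < x) →
  Avoiding high → Avoiding low → Avoiding (high ++ low)
Avoiding-skew {high} low<high high-av low-av q bad with ⊆-++⁻ high q
... | []                , _ , refl , _  , q₂ = low-av q₂ bad
... | _ ∷ []            , _ , refl , q₁ , q₂ =
  <-asym (Bad⇒< bad) (low<high (to∈ q₁) (to∈ (∷ˡ⁻ q₂)))
... | _ ∷ _ ∷ []        , _ , refl , q₁ , q₂ = <-asym (Bad⇒< bad) (low<high (to∈ q₁) (to∈ q₂))
... | _ ∷ _ ∷ _ ∷ []    , _ , refl , q₁ , _  = high-av q₁ bad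
... | _ ∷ _ ∷ _ ∷ _ ∷ _ , _ , ()

-- Extensions of a prefix `p` with least entry `suc k`

module Extension
  (n k : ℕ) (p : List ℕ) (p! : Uniqueₗ p) (p⊆[n] : ∀ {x} → x ∈ p → x ∈ [1⋯ n ])
  (min∈p : suc k ∈ p) (min≤ : ∀ {x} → x ∈ p → suc k ≤ x)
  where

  upper? : Decidable (λ x → suc k < x × x ∉ p)
  upper? x = (suc k <? x) ×-dec ¬? (member? _≟_ x p)

  -- The increasing run forced after the prefix. As `suc k` is the least entry of `p`, the values in
  -- neither `p` nor `upper` are exactly those of `[1⋯ k ]`.
  upper : List ℕ
  upper = filter upper? [1⋯ n ]

  upper-sorted : AllPairs _<_ upper
  upper-sorted = AllPairs.filter⁺ upper? ([1⋯]-sorted n)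

  ∈-upper⁻ : ∀ {x} → x ∈ upper → x ∈ [1⋯ n ] × suc k < x × x ∉ p
  ∈-upper⁻ = ∈-filter⁻ upper?

  ∈-upper⁺ : ∀ {x} → x ∈ [1⋯ n ] → suc k < x → x ∉ p → x ∈ upper
  ∈-upper⁺ x∈ m<x x∉p = ∈-filter⁺ upper? x∈ (m<x , x∉p)

  k<n : k < n
  k<n = proj₂ (to ∈[1⋯]⇔ (p⊆[n] min∈p))

  -- With m = suc k: after m, a low value before a high one gives a 213, and a
  -- descent of two high values gives a 132.
  extension-shape : ∀ {r} → Avoider n (p ++ r) →
    ∃ λ ρ → Avoider k ρ × r ≡ upper ++ ρ
  extension-shape {r} ((pr! , pr⇔) , av) =
    low , ((low! , λ _ → mk⇔ low⊆ ⊆low) , Avoiding-⊆ (⊆-++⁺ˡ p (filter-⊆ (¬? ∘ high?) r)) av) ,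
    trans (sym (filter-++-filter-¬ high? r high-first)) (cong (_++ low) high≡upper)
    where
    high? : Decidable (suc k <_)
    high? = suc k <?_

    low high : List ℕ
    low  = filter (¬? ∘ high?) r
    high = filter high? r

    r! : Uniqueₗ r
    r! = ⊆⇒AllPairs r (AllPairs⇒⊆ pr! ∘ ⊆-++⁺ˡ p)

    r∌p : ∀ {x} → x ∈ p → x ∉ r
    r∌p x∈p x∈r = AllPairs⇒⊆ pr! (⊆-++⁺ (from∈ x∈p) (from∈ x∈r)) refl

    min-av : ∀ {x y} → x ∷ y ∷ [] ⊆ r → ¬ Bad (suc k) x y
    min-av xy⊆r = av (⊆-++⁺ (from∈ min∈p) xy⊆r)

    high-first : ∀ {x y} → x ∷ y ∷ [] ⊆ r → suc k < y → suc k < x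
    high-first {x} xy⊆r m<y with <-cmp (suc k) x
    ... | tri< m<x _ _  = m<x
    ... | tri≈ _ refl _ = contradiction (lookup xy⊆r (here refl)) (r∌p min∈p)
    ... | tri> _ _ x<m  = contradiction (inj₂ (x<m , m<y)) (min-av xy⊆r)

    high≡upper : high ≡ upper
    high≡upper = sorted-unique
      (⊆⇒AllPairs high high-ascending)
      upper-sorted
      (mk⇔
        (λ x∈high → let x∈r , m<x = ∈-filter⁻ high? x∈high in
          ∈-upper⁺ (to (pr⇔ _) (∈-++⁺ʳ p x∈r)) m<x (λ x∈p → r∌p x∈p x∈r))
        (λ x∈upper → let x∈[n] , m<x , x∉p = ∈-upper⁻ x∈upper in
          [ (λ x∈p → contradiction x∈p x∉p) , (λ x∈r → ∈-filter⁺ high? x∈r m<x) ]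
            (∈-++⁻ p (from (pr⇔ _) x∈[n]))))
      where
      high-ascending : ∀ {x y} → x ∷ y ∷ [] ⊆ high → x < y
      high-ascending {x} {y} xy⊆high with <-cmp x y
      ... | tri< x<y _ _  = x<y
      ... | tri≈ _ x≡y _  =
        contradiction x≡y (AllPairs⇒⊆ r! (⊆-trans xy⊆high (filter-⊆ high? r)))
      ... | tri> _ _ y<x  = contradiction
        (inj₁ (proj₂ (∈-filter⁻ high? {xs = r} (to∈ (∷ˡ⁻ xy⊆high))) , y<x))
        (min-av (⊆-trans xy⊆high (filter-⊆ high? r)))

    low! : Uniqueₗ low
    low! = Unique.filter⁺ (¬? ∘ high?) r!

    low⊆ : ∀ {x} → x ∈ low → x ∈ [1⋯ k ]
    low⊆ {x} x∈low =
      let x∈r , m≮x = ∈-filter⁻ (¬? ∘ high?) x∈low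
          1≤x , _   = to ∈[1⋯]⇔ (to (pr⇔ _) (∈-++⁺ʳ p x∈r))
          x≢m       = λ x≡m → r∌p min∈p (subst (_∈ r) x≡m x∈r)
      in from ∈[1⋯]⇔ (1≤x , m<1+n⇒m≤n (≤∧≢⇒< (≮⇒≥ m≮x) x≢m))

    ⊆low : ∀ {x} → x ∈ [1⋯ k ] → x ∈ low
    ⊆low {x} x∈[k] = [ (λ x∈p → contradiction x<m (≤⇒≯ (min≤ x∈p)))
                     , (λ x∈r → ∈-filter⁺ (¬? ∘ high?) x∈r (<⇒≯ x<m)) ]
      (∈-++⁻ p (from (pr⇔ _) (from ∈[1⋯]⇔ (proj₁ (to ∈[1⋯]⇔ x∈[k]) , <⇒≤ (<-≤-trans x<m k<n)))))
      where
      x<m : x < suc k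
      x<m = s≤s (proj₂ (to ∈[1⋯]⇔ x∈[k]))

  unused⇒∈suffix : ∀ {r} → Perm n (p ++ r) → ∀ {x} → x ∈ [1⋯ n ] → x ∉ p → x ∈ r
  unused⇒∈suffix (_ , pr⇔) x∈[n] x∉p =
    [ (λ x∈p → contradiction x∈p x∉p) , id ] (∈-++⁻ p (from (pr⇔ _) x∈[n]))

  -- `Condition₁` for lists: `x` followed by `α` and `β` from the increasing run is a 213.
  Obstruction₁ : Set
  Obstruction₁ = ∃ λ x → ∃ λ α → ∃ λ β →
    x ∈ p × α ∈ upper × β ∈ upper × α < x × x < β

  -- `Condition₂` for lists: its two alternatives are the two ways in which `α`, coming after the
  -- prefix, completes a pair of entries to a 132 or a 213.
  Obstruction₂ : Set
  Obstruction₂ = ∃ λ x → ∃ λ y → ∃ λ α →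
    x ∷ y ∷ [] ⊆ p × (α ∈ [1⋯ n ] × α ∉ p) × Bad x y α

  obstructed₁ : Obstruction₁ → ∀ {r} → ¬ Avoider n (p ++ r)
  obstructed₁ (x , α , β , x∈p , α∈ , β∈ , α<x , x<β) pr-av@(_ , av)
    -- The suffix starts with `upper`, and since `upper` is increasing only the order `α` before `β`
    -- can occur there.
    with extension-shape pr-av | ∈∧∈⇒⊆ (<⇒≢ (<-trans α<x x<β)) α∈ β∈
  ... | ρ , _ , refl | inj₁ αβ⊆ =
    av (⊆-++⁺ (from∈ x∈p) (⊆-++⁺ʳ ρ αβ⊆)) (inj₂ (α<x , x<β))
  ... | _            | inj₂ βα⊆ =
    <-asym (AllPairs⇒⊆ upper-sorted βα⊆) (<-trans α<x x<β)

  obstructed₂ : Obstruction₂ → ∀ {r} → ¬ Avoider n (p ++ r)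
  obstructed₂ (x , y , α , xy⊆p , (α∈[n] , α∉p) , bad) (pr , av) =
    av (⊆-++⁺ xy⊆p (from∈ (unused⇒∈suffix pr α∈[n] α∉p))) bad

  module _ (p-av : Avoiding p) (¬obs₁ : ¬ Obstruction₁) (¬obs₂ : ¬ Obstruction₂) where

    -- Split by the number of entries in `p`. With none, the descent present in both patterns
    -- contradicts the sortedness of `upper`; with one, the last two entries ascend, which leaves a
    -- 213 and hence `Obstruction₁`; with two, `Obstruction₂` arises; with three, `p` itself
    -- contains the pattern.
    p++upper-avoiding : Avoiding (p ++ upper)
    p++upper-avoiding q bad with ⊆-++⁻ p q
    ... | [] , _ , refl , _ , q₂ = ascending bad
      where
      ascending : ¬ Bad _ _ _
      ascending (inj₁ (_ , z<y)) = <-asym z<y (AllPairs⇒⊆ upper-sorted (∷ˡ⁻ q₂))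
      ascending (inj₂ (y<x , _)) =
        <-asym y<x (AllPairs⇒⊆ upper-sorted (⊆-trans (refl ∷ refl ∷ []⊆ _) q₂))
    ... | _ ∷ [] , _ , refl , q₁ , q₂ with bad
    ...   | inj₁ (_ , z<y)   = <-asym z<y (AllPairs⇒⊆ upper-sorted q₂)
    ...   | inj₂ (y<x , x<z) =
      ¬obs₁ (_ , _ , _ , to∈ q₁ , to∈ q₂ , to∈ (∷ˡ⁻ q₂) , y<x , x<z)
    p++upper-avoiding q bad | _ ∷ _ ∷ [] , _ , refl , q₁ , q₂ =
      let z∈[n] , _ , z∉p = ∈-upper⁻ (to∈ q₂) in ¬obs₂ (_ , _ , _ , q₁ , (z∈[n] , z∉p) , bad)
    p++upper-avoiding q bad | _ ∷ _ ∷ _ ∷ [] , _ , refl , q₁ , _ = p-av q₁ bad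
    p++upper-avoiding q bad | _ ∷ _ ∷ _ ∷ _ ∷ _ , _ , ()

    -- Entries of `p ++ upper` are at least `suc k` and those of `ρ` at most `k`, so `Avoiding-skew`
    -- applies for every `ρ`.
    extension-avoider : ∀ {ρ} → Avoider k ρ → Avoider n (p ++ upper ++ ρ)
    extension-avoider {ρ} ((ρ! , ρ⇔) , ρ-av) =
      (subst Uniqueₗ assoc l! , λ x → mk⇔ (l⊆ x) (⊆l x)) ,
      subst Avoiding assoc (Avoiding-skew ρ<p++upper p++upper-avoiding ρ-av)
      where
      assoc : (p ++ upper) ++ ρ ≡ p ++ upper ++ ρ
      assoc = ++-assoc p upper ρ

      ρ<p++upper : ∀ {x z} → x ∈ p ++ upper → z ∈ ρ → z < x
      ρ<p++upper x∈ z∈ρ = <-≤-trans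
        (s≤s (proj₂ (to ∈[1⋯]⇔ (to (ρ⇔ _) z∈ρ))))
        ([ min≤ , <⇒≤ ∘ proj₁ ∘ proj₂ ∘ ∈-upper⁻ ] (∈-++⁻ p x∈))

      l! : Uniqueₗ ((p ++ upper) ++ ρ)
      l! = Unique.++⁺
        (Unique.++⁺ p! (AllPairs.map <⇒≢ upper-sorted)
          (λ (x∈p , x∈upper) → proj₂ (proj₂ (∈-upper⁻ x∈upper)) x∈p))
        ρ!
        (λ (x∈ , x∈ρ) → <-irrefl refl (ρ<p++upper x∈ x∈ρ))

      l⊆ : ∀ x → x ∈ p ++ upper ++ ρ → x ∈ [1⋯ n ]
      l⊆ x x∈l with ∈-++⁻ p x∈l
      ... | inj₁ x∈p = p⊆[n] x∈p
      ... | inj₂ x∈s with ∈-++⁻ upper x∈s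
      ...   | inj₁ x∈upper = proj₁ (∈-upper⁻ x∈upper)
      ...   | inj₂ x∈ρ     = let 1≤x , x≤k = to ∈[1⋯]⇔ (to (ρ⇔ x) x∈ρ) in
        from ∈[1⋯]⇔ (1≤x , ≤-trans x≤k (<⇒≤ k<n))

      ⊆l : ∀ x → x ∈ [1⋯ n ] → x ∈ p ++ upper ++ ρ
      ⊆l x x∈[n] with member? _≟_ x p | <-cmp (suc k) x
      ... | yes x∈p | _             = ∈-++⁺ˡ x∈p
      ... | no x∉p  | tri< m<x _ _  = ∈-++⁺ʳ p (∈-++⁺ˡ (∈-upper⁺ x∈[n] m<x x∉p))
      ... | no x∉p  | tri≈ _ refl _ = contradiction min∈p x∉p
      ... | no x∉p  | tri> _ _ x<m  = ∈-++⁺ʳ p (∈-++⁺ʳ upper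
        (from (ρ⇔ x) (from ∈[1⋯]⇔ (proj₁ (to ∈[1⋯]⇔ x∈[n]) , m<1+n⇒m≤n x<m))))

    -- The map sending `ρ` to `p ++ upper ++ ρ` is injective by cancellation, and `extension-shape`
    -- shows that it reaches every avoider with prefix `p`.
    card-extensions : ∀ {a} → HasCardinality (Avoider k) a →
      HasCardinality (λ l → Avoider n l × ∃ λ r → l ≡ p ++ r) a
    card-extensions card = card-cong
      (λ l → mk⇔
        (λ where (ρ , ρ-av , refl) → extension-avoider ρ-av , upper ++ ρ , refl)
        (λ where (av , r , refl) → let ρ , ρ-av , eq = extension-shape av in
                                   ρ , ρ-av , cong (p ++_) eq))
      (card-image (λ ρ → p ++ upper ++ ρ)
        (λ eq → ++-cancelˡ upper _ _ (++-cancelˡ p _ _ eq)) card)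

-- Counting by first entry

-- Bounding the first entry by `j`, instead of fixing it, turns the sum over first entries into an
-- induction on `j`.
Leading : ℕ → ℕ → List ℕ → Set
Leading n j l = Avoider n l × ∃ λ a → a ≤ j × ∃ λ r → l ≡ a ∷ r

card-Leading-suc : ∀ {n j a b} → j < n →
  HasCardinality (Leading n j) a → HasCardinality (Avoider j) b →
  HasCardinality (Leading n (suc j)) (a + b)
card-Leading-suc {n} {j} j<n below exact = card-cong
  (λ l → mk⇔
    (λ where
      (inj₁ (av , a , a≤j , eq)) → av , a , m≤n⇒m≤1+n a≤j , eq
      (inj₂ (av , eq))           → av , suc j , ≤-refl , eq)
    (λ (av , a , a≤1+j , r , eq) →
      Sum.map
        (λ a<1+j → av , a , m<1+n⇒m≤n a<1+j , r , eq)
        (λ a≡1+j → av , r , trans eq (cong (_∷ r) a≡1+j))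
        (m≤n⇒m<n∨m≡n a≤1+j)))
  (card-⊎
    (λ where _ (_ , _ , a≤j , _ , refl) (_ , _ , refl) → 1+n≰n a≤j)
    below
    (card-extensions
      -- The prefix is the single entry `suc j`, too short for a pattern. It is its own minimum, so
      -- no value of `upper` lies below it, and it has no pair of entries for `Obstruction₂`.
      (λ where (_ ∷ʳ ())
               (_ ∷ ()))
      (λ where (_ , _ , _ , here refl , α∈ , _ , α<x , _) →
                 <-asym α<x (proj₁ (proj₂ (∈-upper⁻ α∈))))
      (λ where (_ , _ , _ , (_ ∷ʳ ()) , _)
               (_ , _ , _ , (_ ∷ ()) , _))
      exact))
  where
  open Extension n j (suc j ∷ []) ([] ∷ [])
    (Allₗ.lookup {P = _∈ [1⋯ n ]} (from ∈[1⋯]⇔ (s≤s z≤n , j<n) ∷ []))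
    (here refl) (Allₗ.lookup {P = suc j ≤_} (≤-refl ∷ []))

-- An avoider of a nonempty range has a first entry, and the bound `suc n` holds for it
-- automatically.
Leading⇔Avoider : ∀ {n} l → Leading (suc n) (suc n) l ⇔ Avoider (suc n) l
Leading⇔Avoider []      = mk⇔ proj₁
  (λ ((_ , l⇔) , _) → contradiction (from (l⇔ 1) (here refl)) λ ())
Leading⇔Avoider (a ∷ r) = mk⇔ proj₁
  (λ where av@((_ , l⇔) , _) →
             av , a , proj₂ (to ∈[1⋯]⇔ (to (l⇔ a) (here refl))) , r , refl)

card-Avoider-zero : HasCardinality (Avoider 0) 1
card-Avoider-zero = [] ∷ [] , [] ∷ [] , [[]]⇔ , refl
  where
  [[]]⇔ : ∀ l → l ∈ [] ∷ [] ⇔ Avoider 0 l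
  [[]]⇔ []      = mk⇔ (λ _ → ([] , λ _ → mk⇔ id id) , λ ()) (λ _ → here refl)
  [[]]⇔ (x ∷ _) = mk⇔
    (λ where (here ())
             (there ()))
    (λ ((_ , l⇔) , _) → contradiction (to (l⇔ x) (here refl)) λ ())

-- The count does not depend on `n`. In the step, the avoiders of `[1⋯ suc j ]` that follow the new
-- first entry are counted by the same statement at `j` with `n = suc j`, so the number doubles.
card-Leading : ∀ {n} j → j < n → HasCardinality (Leading n (suc j)) (2 ^ j)
card-Leading zero    0<n = card-Leading-suc 0<n
  -- No first entry is at most 0, so the count 1 comes from the single avoider of the empty range.
  (card-∅ λ where
    _ (((_ , l⇔) , _) , _ , z≤n , _ , refl) →
      contradiction (proj₁ (to ∈[1⋯]⇔ (to (l⇔ 0) (here refl)))) λ ())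
  card-Avoider-zero
card-Leading (suc j) j<n = subst (HasCardinality _)
  (cong (2 ^ j +_) (sym (+-identityʳ (2 ^ j))))
  (card-Leading-suc j<n
    (card-Leading j (<⇒≤ j<n))
    (card-cong Leading⇔Avoider (card-Leading j ≤-refl)))

-- Truncated subtraction covers `k = 0`, where the empty permutation is the only avoider.
card-Avoider : ∀ k → HasCardinality (Avoider k) (2 ^ (k ∸ 1))
card-Avoider zero    = card-Avoider-zero
card-Avoider (suc k) = card-cong Leading⇔Avoider (card-Leading k ≤-refl)

-- Translation from vectors to lists

-- Turns a sublist into the increasing map of positions by which `_contains_` describes an
-- occurrence.
⊆⇒embedding : ∀ {m l} (v : Vec ℕ m) → l ⊆ toList v →
  Σ[ ι ∈ (Fin (length l) → Fin m) ]
    (∀ a b → a Fin.< b → ι a Fin.< ι b) × (∀ a → Vec.lookup v (ι a) ≡ List.lookup l a)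
⊆⇒embedding []      []         = (λ ()) , (λ ()) , λ ()
⊆⇒embedding (_ ∷ v) (_ ∷ʳ q)   =
  let ι , mono , eq = ⊆⇒embedding v q in suc ∘ ι , (λ a b → s<s ∘ mono a b) , eq
⊆⇒embedding (x ∷ v) (refl ∷ q) =
  let ι , mono , eq = ⊆⇒embedding v q in
  (λ where zero    → zero
           (suc a) → suc (ι a)) ,
  (λ where zero    (suc _) _         → z<s
           (suc a) (suc b) (s<s a<b) → s<s (mono a b a<b)) ,
  (λ where zero    → refl
           (suc a) → eq a)

lookup∈ : ∀ {m} (v : Vec ℕ m) i → Vec.lookup v i ∈ toList v
lookup∈ v i = ∈-toList⁺ (∈-lookup i v)

lookup-⊆₂ : ∀ {m} (v : Vec ℕ m) {i j} → i Fin.< j →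
  Vec.lookup v i ∷ Vec.lookup v j ∷ [] ⊆ toList v
lookup-⊆₂ (x ∷ v) {zero}  {suc j} _         = refl ∷ from∈ (lookup∈ v j)
lookup-⊆₂ (x ∷ v) {suc i} {suc j} (s<s i<j) = x ∷ʳ lookup-⊆₂ v i<j

lookup-⊆₃ : ∀ {m} (v : Vec ℕ m) {i j k} → i Fin.< j → j Fin.< k →
  Vec.lookup v i ∷ Vec.lookup v j ∷ Vec.lookup v k ∷ [] ⊆ toList v
lookup-⊆₃ (x ∷ v) {zero}  {suc j} {suc k} _         (s<s j<k) = refl ∷ lookup-⊆₂ v j<k
lookup-⊆₃ (x ∷ v) {suc i} {suc j} {suc k} (s<s i<j) (s<s j<k) = x ∷ʳ lookup-⊆₃ v i<j j<k

module _ {m} (v : Vec ℕ m) where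

  contains⁺ : ∀ {x y z s₀ s₁ s₂} → x ∷ y ∷ z ∷ [] ⊆ toList v →
    x < y ⇔ s₀ < s₁ → x < z ⇔ s₀ < s₂ → y < z ⇔ s₁ < s₂ →
    v contains (s₀ ∷ s₁ ∷ s₂ ∷ [])
  contains⁺ {x} {y} {z} {s₀} {s₁} {s₂} q xy xz yz with ⊆⇒embedding v q
  ... | ι , mono , eq = ι , mono , λ a b a<b →
    subst₂ (λ u w → u < w ⇔ _) (sym (eq a)) (sym (eq b)) (order a b a<b)
    where
    order : ∀ a b → a Fin.< b →
      List.lookup (x ∷ y ∷ z ∷ []) a < List.lookup (x ∷ y ∷ z ∷ []) b ⇔
      Vec.lookup (s₀ ∷ s₁ ∷ s₂ ∷ []) a < Vec.lookup (s₀ ∷ s₁ ∷ s₂ ∷ []) b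
    order zero       (suc zero)       _ = xy
    order zero       (suc (suc zero)) _ = xz
    order (suc zero) (suc (suc zero)) _ = yz
    order (suc zero) (suc zero) (s<s ())
    order (suc (suc zero)) (suc zero) (s<s ())
    order (suc (suc zero)) (suc (suc zero)) (s<s (s<s ()))

  contains⁻ : ∀ {s₀ s₁ s₂} → v contains (s₀ ∷ s₁ ∷ s₂ ∷ []) →
    ∃ λ x → ∃ λ y → ∃ λ z → x ∷ y ∷ z ∷ [] ⊆ toList v ×
      (x < y ⇔ s₀ < s₁) × (x < z ⇔ s₀ < s₂) × (y < z ⇔ s₁ < s₂)
  contains⁻ (ι , mono , order) =
    _ , _ , _ , lookup-⊆₃ v (mono i₀ i₁ z<s) (mono i₁ i₂ (s<s z<s)) ,
    order i₀ i₁ z<s , order i₀ i₂ z<s , order i₁ i₂ (s<s z<s)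
    where
    i₀ i₁ i₂ : Fin 3
    i₀ = zero
    i₁ = suc zero
    i₂ = suc (suc zero)

  -- The two inequalities of `Bad` determine the order of all three entries; the other comparisons
  -- follow by transitivity and asymmetry.
  avoids⇒Avoiding : v avoids p132 → v avoids p213 → Avoiding (toList v)
  avoids⇒Avoiding av132 av213 q (inj₁ (x<z , z<y)) = av132 (contains⁺ q
    (mk⇔ (λ _ → s<s z<s) (λ _ → <-trans x<z z<y))
    (mk⇔ (λ _ → s<s z<s) (λ _ → x<z))
    (mk⇔ (λ y<z → contradiction z<y (<-asym y<z)) (λ where (s<s (s<s ())))))
  avoids⇒Avoiding av132 av213 q (inj₂ (y<x , x<z)) = av213 (contains⁺ q
    (mk⇔ (λ x<y → contradiction x<y (<-asym y<x)) (λ where (s<s ())))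
    (mk⇔ (λ _ → s<s (s<s z<s)) (λ _ → x<z))
    (mk⇔ (λ _ → s<s z<s) (λ _ → <-trans y<x x<z)))

  module _ (v! : Uniqueₗ (toList v)) (v-av : Avoiding (toList v)) where

    -- A descent in the pattern only says that the earlier entry is not smaller; distinctness of the
    -- entries makes the inequality strict, as `Bad` demands.
    Avoiding⇒avoids132 : v avoids p132
    Avoiding⇒avoids132 c with contains⁻ c
    ... | x , y , z , q , xy , xz , yz = v-av q (inj₁
      (from xz (s<s z<s) , ≤∧≢⇒< (≮⇒≥ y≮z) (AllPairs⇒⊆ v! (∷ˡ⁻ q) ∘ sym)))
      where
      y≮z : ¬ y < z
      y≮z y<z with to yz y<z
      ... | s<s (s<s ())

    Avoiding⇒avoids213 : v avoids p213
    Avoiding⇒avoids213 c with contains⁻ c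
    ... | x , y , z , q , xy , xz , yz = v-av q (inj₂
      (≤∧≢⇒< (≮⇒≥ x≮y) (AllPairs⇒⊆ v! (⊆-trans (refl ∷ refl ∷ []⊆ _) q) ∘ sym) ,
       from xz (s<s (s<s z<s))))
      where
      x≮y : ¬ x < y
      x≮y x<y with to xy x<y
      ... | s<s ()

Unique-toList : ∀ {m} {v : Vec ℕ m} → Unique v → Uniqueₗ (toList v)
Unique-toList []        = []
Unique-toList (px ∷ v!) = All.toList⁺ px ∷ Unique-toList v!

minimum∈ : ∀ {t} .{{_ : NonZero t}} (c : Vec ℕ t) → minimum c ∈ toList c
minimum∈ (x ∷ [])    = here refl
minimum∈ (x ∷ y ∷ c) =
  [ here , (λ eq → there (subst (_∈ toList (y ∷ c)) (sym eq) (minimum∈ (y ∷ c)))) ]′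
    (⊓-sel x (minimum (y ∷ c)))

minimum≤ : ∀ {t} .{{_ : NonZero t}} (c : Vec ℕ t) {x} → x ∈ toList c → minimum c ≤ x
minimum≤ (x ∷ [])    (here refl) = ≤-refl
minimum≤ (x ∷ y ∷ c) (here refl) = m⊓n≤m x _
minimum≤ (x ∷ y ∷ c) (there z∈)  = ≤-trans (m⊓n≤n x _) (minimum≤ (y ∷ c) z∈)

take-toList-++ : ∀ {t} (c : Vec ℕ t) (r : List ℕ) → List.take t (toList c ++ r) ≡ toList c
take-toList-++ []      r = refl
take-toList-++ (x ∷ c) r = cong (x ∷_) (take-toList-++ c r)

S⇔Avoider : ∀ n {t} (c : Vec ℕ t) (τ : Vec ℕ n) →
  (Avoider n (toList τ) × ∃ λ r → toList τ ≡ toList c ++ r) ⇔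
  S n c ((3 , p132) ∷ (3 , p213) ∷ []) τ
S⇔Avoider n {t} c τ = mk⇔
  (λ ((τₚ@(τ! , _) , av) , r , eq) →
    from ↭⇔Perm τₚ ,
    trans (cong (List.take t) eq) (take-toList-++ c r) ,
    Avoiding⇒avoids132 τ τ! av ∷ Avoiding⇒avoids213 τ τ! av ∷ [])
  (λ where
    (τ↭ , prefix , av132 ∷ av213 ∷ []) →
      (to ↭⇔Perm τ↭ , avoids⇒Avoiding τ av132 av213) ,
      List.drop t (toList τ) ,
      trans (sym (take++drop≡id t (toList τ))) (cong (_++ List.drop t (toList τ)) prefix))

theorem5p6 : (n t : ℕ) .{{_ : NonZero t}} → 3 ≤ n → t < n →
    (c : Vec ℕ t) → All (_∈ [1⋯ n ]) c → Unique c →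
    c avoids p132 → c avoids p213 →
    let S[132,213] = S n c ((3 , p132) ∷ (3 , p213) ∷ []) in
    (Condition₁ n c → HasCardinality S[132,213] 0) ×
    (Condition₂ n c → HasCardinality S[132,213] 0) ×
    (¬ Condition₁ n c → ¬ Condition₂ n c →
    HasCardinality S[132,213] (2 ^ (minimum c ∸ 2)))
theorem5p6 n t _ _ c c⊆[n] c! av132 av213
  -- Abstracting the minimum with its two properties lets it be matched as `suc k`, the form that
  -- `Extension` takes; 0 is excluded because entries are at least 1.
  with minimum c | minimum∈ c | (λ {x} → minimum≤ c {x})
... | zero  | min∈c | min≤ =
  contradiction (proj₁ (to ∈[1⋯]⇔ (Allₗ.lookup (All.toList⁺ c⊆[n]) min∈c))) λ ()
... | suc k | min∈c | min≤ =
  (λ (α , β , i , (α∈[n] , α∉c) , (β∈[n] , β∉c) , m<α , α<cᵢ , cᵢ<β) →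
    empty (obstructed₁
      ( Vec.lookup c i , α , β , lookup∈ c i
      , ∈-upper⁺ α∈[n] m<α (α∉c ∘ ∈-toList⁻)
      , ∈-upper⁺ β∈[n] (<-trans m<α (<-trans α<cᵢ cᵢ<β)) (β∉c ∘ ∈-toList⁻)
      , α<cᵢ , cᵢ<β))) ,
  (λ (α , i , j , (α∈[n] , α∉c) , i<j , bad) →
    empty (obstructed₂
      (_ , _ , α , lookup-⊆₂ c i<j , (α∈[n] , α∉c ∘ ∈-toList⁻) , bad))) ,
  -- The exponent `suc k ∸ 2` computes to the `k ∸ 1` of `card-Avoider k`.
  (λ ¬cond₁ ¬cond₂ → card-cong (S⇔Avoider n c)
    (card-toList (λ ((lₚ , _) , _) → Perm⇒length lₚ)
      (card-extensions (avoids⇒Avoiding c av132 av213)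
        (¬cond₁ ∘ obstruction₁⇒condition₁) (¬cond₂ ∘ obstruction₂⇒condition₂)
        (card-Avoider k))))
  where
  open Extension n k (toList c) (Unique-toList c!) (Allₗ.lookup (All.toList⁺ c⊆[n])) min∈c min≤

  empty : (∀ {r} → ¬ Avoider n (toList c ++ r)) →
    HasCardinality (S n c ((3 , p132) ∷ (3 , p213) ∷ [])) 0
  empty ¬av = card-∅ λ τ τ∈S → let av , r , eq = from (S⇔Avoider n c τ) τ∈S in
    ¬av (subst (Avoider n) eq av)

  -- The conclusion is `Condition₁` written out with `suc k` for `minimum c`, since the minimum has
  -- been abstracted at this point.
  obstruction₁⇒condition₁ : Obstruction₁ → ∃ λ α → ∃ λ β → Σ[ i ∈ Fin t ]
    Unused n c α × Unused n c β × suc k < α × α < Vec.lookup c i × Vec.lookup c i < β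
  obstruction₁⇒condition₁ (x , α , β , x∈c , α∈ , β∈ , α<x , x<β) =
    let ι , _ , eq        = ⊆⇒embedding c (from∈ x∈c)
        α∈[n] , m<α , α∉c = ∈-upper⁻ α∈
        β∈[n] , _ , β∉c   = ∈-upper⁻ β∈
    in α , β , ι zero , (α∈[n] , α∉c ∘ ∈-toList⁺) , (β∈[n] , β∉c ∘ ∈-toList⁺) , m<α ,
       subst (α <_) (sym (eq zero)) α<x , subst (_< β) (sym (eq zero)) x<β

  obstruction₂⇒condition₂ : Obstruction₂ → Condition₂ n c
  obstruction₂⇒condition₂ (x , y , α , xy⊆c , (α∈[n] , α∉c) , bad) =
    let ι , mono , eq = ⊆⇒embedding c xy⊆c
        i<j = mono zero (suc zero) z<s
    in α , ι zero , ι (suc zero) , (α∈[n] , α∉c ∘ ∈-toList⁺) , i<j ,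
       subst₂ (λ x y → Bad x y α) (sym (eq zero)) (sym (eq (suc zero))) bad
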